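{- Let $k$ be a positive integer. The binomial transform $\{b_{k,n}\}_{n\ge 0}$ of the higher order Mersenne numbers satisfies $$b_{k,n+1}=(2+m_k)\,b_{k,n}-2m_k\,b_{k,n-1}, \quad n\geq 1,$$ with initial conditions $b_{k,0}=0$ and $b_{k,1}=1$, where $m_k$ is the $k$th Mersenne-Lucas number.
   Context: The Mersenne numbers $\{M_n\}_{n\ge 0}$ are defined by $M_0=0$, $M_1=1$, $M_{n+2}=3M_{n+1}-2M_n$, i.e. $M_n=2^n-1$. The Mersenne-Lucas numbers satisfy the same recurrence with $m_0=2$, $m_1=3$, i.e. $m_n=2^n+1$. For a positive integer $k$, the higher order Mersenne numbers are $M_n^{(k)}=M_{kn}/M_k$ for $n=0,1,2,\dots$, and their binomial transform is $b_{k,n}=\sum_{i=0}^{n}\binom{n}{i}M_i^{(k)}$ for $n\ge 0$. -}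

module Defs where

open import Data.Fin.Base using (toℕ)
open import Data.Integer.Base as ℤ using (ℤ; +_; 0ℤ; 1ℤ)
import Data.Integer.Properties as ℤ
open import Data.Integer.Tactic.RingSolver using (solve-∀)
open import Data.Nat.Base as ℕ using (ℕ; suc)
open import Data.Nat.Combinatorics using (_C_)
import Data.Nat.Properties as ℕ
open import Data.Rational.Base using (ℚ; _*_; _÷_; NonZero)
open import Data.Rational.Literals using (fromℤ)
import Data.Rational.Properties as ℚ
open import Algebra.Bundles using (CommutativeRing)
open import Algebra.Properties.Monoid.Sum
  (CommutativeRing.+-monoid ℚ.+-*-commutativeRing) using (sum⁺-syntax)
open import Relation.Binary.PropositionalEquality
  using (_≡_; _≢_; refl; sym; trans; cong; cong₂; module ≡-Reasoning)

-- Integer-valued, so that the subtraction in the recurrences is not truncated.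

mersenne : ℕ → ℤ
mersenne 0             = + 0
mersenne 1             = + 1
mersenne (suc (suc n)) = + 3 ℤ.* mersenne (suc n) ℤ.- + 2 ℤ.* mersenne n

mersenneLucas : ℕ → ℤ
mersenneLucas 0             = + 2
mersenneLucas 1             = + 3
mersenneLucas (suc (suc n)) =
  + 3 ℤ.* mersenneLucas (suc n) ℤ.- + 2 ℤ.* mersenneLucas n

mersenne-closed : ∀ n → mersenne n ≡ + (2 ℕ.^ n) ℤ.- 1ℤ
mersenne-closed 0             = refl
mersenne-closed 1             = refl
mersenne-closed (suc (suc n)) = begin
  + 3 ℤ.* mersenne (suc n) ℤ.- + 2 ℤ.* mersenne n
    ≡⟨ cong₂ (λ x y → + 3 ℤ.* x ℤ.- + 2 ℤ.* y)
             (mersenne-closed (suc n)) (mersenne-closed n) ⟩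
  + 3 ℤ.* (+ (2 ℕ.* p) ℤ.- 1ℤ) ℤ.- + 2 ℤ.* (+ p ℤ.- 1ℤ)
    ≡⟨ cong (λ x → + 3 ℤ.* (x ℤ.- 1ℤ) ℤ.- + 2 ℤ.* (+ p ℤ.- 1ℤ)) (ℤ.pos-* 2 p) ⟩
  + 3 ℤ.* (+ 2 ℤ.* + p ℤ.- 1ℤ) ℤ.- + 2 ℤ.* (+ p ℤ.- 1ℤ)
    ≡⟨ identity (+ p) ⟩
  + 2 ℤ.* (+ 2 ℤ.* + p) ℤ.- 1ℤ
    ≡⟨ cong (λ x → + 2 ℤ.* x ℤ.- 1ℤ) (ℤ.pos-* 2 p) ⟨
  + 2 ℤ.* + (2 ℕ.* p) ℤ.- 1ℤ
    ≡⟨ cong (ℤ._- 1ℤ) (ℤ.pos-* 2 (2 ℕ.* p)) ⟨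
  + (2 ℕ.* (2 ℕ.* p)) ℤ.- 1ℤ ∎
  where
  open ≡-Reasoning
  p = 2 ℕ.^ n
  identity : ∀ x → + 3 ℤ.* (+ 2 ℤ.* x ℤ.- + 1) ℤ.- + 2 ℤ.* (x ℤ.- + 1)
                 ≡ + 2 ℤ.* (+ 2 ℤ.* x) ℤ.- + 1
  identity = solve-∀

mersenne≢0 : ∀ k → .{{ℕ.NonZero k}} → mersenne k ≢ 0ℤ
mersenne≢0 (suc k) M≡0 = ℕ.1+n≢0 (ℕ.suc-injective (ℕ.m*n≡1⇒m≡1 2 (2 ℕ.^ k) 2^k≡1))
  where
  2^k≡1 : 2 ℕ.^ suc k ≡ 1
  2^k≡1 = ℤ.+-injective
    (ℤ.i-j≡0⇒i≡j _ _ (trans (sym (mersenne-closed (suc k))) M≡0))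

mersenne-nonZero : ∀ k → .{{ℕ.NonZero k}} → NonZero (fromℤ (mersenne k))
mersenne-nonZero k = ℤ.≢-nonZero (mersenne≢0 k)

higherMersenne : (k : ℕ) → .{{ℕ.NonZero k}} → ℕ → ℚ
higherMersenne k n = fromℤ (mersenne (k ℕ.* n)) ÷ fromℤ (mersenne k)
  where instance _ = mersenne-nonZero k

binomialTransform : (ℕ → ℚ) → ℕ → ℚ
binomialTransform a n = ∑[ i ≤ n ] (fromℤ (+ (n C toℕ i)) * a (toℕ i))

b : (k : ℕ) → .{{ℕ.NonZero k}} → ℕ → ℚ
b k = binomialTransform (higherMersenne k)

{-# OPTIONS --safe #-}
module Submission where

-- By Pascal's rule the binomial transform T satisfies T a (n + 1) = T a n + T (S a) n, where S is
-- the shift.  Hence a recurrence S² a = p · S a + q · a becomes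
--   T a (n + 2) = (2 + p) · T a (n + 1) − (1 + p − q) · T a n.
-- For the higher order Mersenne numbers p = mₖ = 2ᵏ + 1 and q = −2ᵏ = 1 − mₖ, so 1 + p − q = 2 mₖ.

open import Defs
open import Algebra.Bundles using (CommutativeRing)
open import Data.Fin.Base using (Fin; toℕ; fromℕ; inject₁)
open import Data.Fin.Properties using (toℕ-fromℕ; toℕ-inject₁)
open import Data.Integer.Base as ℤ using (+_; +0; +[1+_]; -[1+_]; 1ℤ)
import Data.Integer.Properties as ℤ
open import Data.Integer.Tactic.RingSolver using (solve-∀)
open import Data.Nat.Base as ℕ using (ℕ; suc; _≤_; _∸_; s≤s)
open import Data.Nat.Combinatorics using (_C_; nCk+nC[k+1]≡[n+1]C[k+1])
open import Data.Nat.Combinatorics.Specification using (k>n⇒nCk≡0)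
import Data.Nat.Properties as ℕ
open import Data.Product.Base using (_×_; _,_)
open import Data.Rational.Base using (ℚ; 0ℚ; 1ℚ; _+_; _*_; _-_; -_; 1/_)
open import Data.Rational.Literals using (fromℤ)
import Data.Rational.Properties as ℚ
open import Data.Rational.Solver using (module +-*-Solver)
open import Data.Rational.Unnormalised.Base using (*≡*)
import Data.Rational.Unnormalised.Properties as ℚᵘ
open import Function.Base using (_∘_)
open import Relation.Binary.PropositionalEquality
  using (_≡_; refl; sym; trans; cong; cong₂; module ≡-Reasoning)

open import Algebra.Properties.Semiring.Sum
  (CommutativeRing.semiring ℚ.+-*-commutativeRing)
  using (sum⁺-syntax; sum-cong-≗; sum-init-last; ∑-distrib-+; *-distribˡ-sum)

open ≡-Reasoning

-- Addition in ℚ normalises by a gcd and is stuck on variables. In unnormalised fractions equality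
-- is cross-multiplication, which for denominators 1 is a ring identity in ℤ.
fromℤ-homo-+ : ∀ x y → fromℤ (x ℤ.+ y) ≡ fromℤ x + fromℤ y
fromℤ-homo-+ x y = ℚ.toℚᵘ-injective
  (ℚᵘ.≃-trans (*≡* (identity x y)) (ℚᵘ.≃-sym (ℚ.toℚᵘ-homo-+ (fromℤ x) (fromℤ y))))
  where
  identity : ∀ x y → (x ℤ.+ y) ℤ.* + 1 ≡ (x ℤ.* + 1 ℤ.+ y ℤ.* + 1) ℤ.* + 1
  identity = solve-∀

fromℤ-homo-* : ∀ x y → fromℤ (x ℤ.* y) ≡ fromℤ x * fromℤ y
fromℤ-homo-* x y = ℚ.toℚᵘ-injective
  (ℚᵘ.≃-trans (*≡* refl) (ℚᵘ.≃-sym (ℚ.toℚᵘ-homo-* (fromℤ x) (fromℤ y))))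

fromℤ-homo‿- : ∀ x → fromℤ (ℤ.- x) ≡ - fromℤ x
fromℤ-homo‿- +0       = refl
fromℤ-homo‿- +[1+ _ ] = refl
fromℤ-homo‿- -[1+ _ ] = refl

fromℤ-homo-- : ∀ x y → fromℤ (x ℤ.- y) ≡ fromℤ x - fromℤ y
fromℤ-homo-- x y = trans (fromℤ-homo-+ x (ℤ.- y)) (cong (_+_ (fromℤ x)) (fromℤ-homo‿- y))

-- The summand at index 0 is set aside, and Pascal's rule splits each other one: the `f` parts form
-- the transform of the shift, the `g` parts are the summands of `T a` from index 1 on.
binomialTransform-suc : ∀ a n →
  binomialTransform a (suc n) ≡ binomialTransform a n + binomialTransform (a ∘ suc) n
binomialTransform-suc a n = begin
  1a₀ + ∑[ i ≤ n ] (fromℤ (+ (suc n C suc (toℕ i))) * a (suc (toℕ i)))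
    ≡⟨ cong (_+_ 1a₀) (sum-cong-≗ (pascal ∘ toℕ {suc n})) ⟩
  1a₀ + ∑[ i ≤ n ] (f (toℕ i) + g (toℕ i))
    ≡⟨ cong (_+_ 1a₀) (∑-distrib-+ {suc n} (f ∘ toℕ) (g ∘ toℕ)) ⟩
  1a₀ + (binomialTransform (a ∘ suc) n + ∑[ i ≤ n ] g (toℕ i))
    ≡⟨ solve 3 (λ x y z → x :+ (y :+ z) := (x :+ z) :+ y) refl
         1a₀ (binomialTransform (a ∘ suc) n) (∑[ i ≤ n ] g (toℕ i)) ⟩
  -- Both `suc n C 0` and `n C 0` compute to 1, so `1a₀` serves as the summand `h 0` in front of the
  -- `g` parts.
  ∑[ i ≤ suc n ] h (toℕ i) + binomialTransform (a ∘ suc) n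
    ≡⟨ cong (_+ binomialTransform (a ∘ suc) n) drop-last ⟩
  binomialTransform a n + binomialTransform (a ∘ suc) n ∎
  where
  open +-*-Solver
  f g h : ℕ → ℚ
  f i = fromℤ (+ (n C i)) * a (suc i)
  h i = fromℤ (+ (n C i)) * a i
  g i = h (suc i)
  1a₀ = fromℤ (+ 1) * a 0

  pascal : ∀ i → fromℤ (+ (suc n C suc i)) * a (suc i) ≡ f i + g i
  pascal i = begin
    fromℤ (+ (suc n C suc i)) * a (suc i)
      ≡⟨ cong (λ c → fromℤ (+ c) * a (suc i)) (nCk+nC[k+1]≡[n+1]C[k+1] n i) ⟨
    fromℤ (+ (n C i) ℤ.+ + (n C suc i)) * a (suc i)
      ≡⟨ cong (_* a (suc i)) (fromℤ-homo-+ (+ (n C i)) (+ (n C suc i))) ⟩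
    (fromℤ (+ (n C i)) + fromℤ (+ (n C suc i))) * a (suc i)
      ≡⟨ ℚ.*-distribʳ-+ (a (suc i)) (fromℤ (+ (n C i))) (fromℤ (+ (n C suc i))) ⟩
    f i + g i ∎

  -- The sum of `h` runs one index past the transform at `n`; the extra coefficient `n C suc n`
  -- vanishes.
  h-last : h (toℕ (fromℕ (suc n))) ≡ 0ℚ
  h-last = begin
    h (toℕ (fromℕ (suc n)))           ≡⟨ cong h (toℕ-fromℕ (suc n)) ⟩
    fromℤ (+ (n C suc n)) * a (suc n)
      ≡⟨ cong (λ c → fromℤ (+ c) * a (suc n)) (k>n⇒nCk≡0 (ℕ.n<1+n n)) ⟩
    0ℚ * a (suc n)                    ≡⟨ ℚ.*-zeroˡ (a (suc n)) ⟩
    0ℚ                                ∎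

  drop-last : ∑[ i ≤ suc n ] h (toℕ i) ≡ binomialTransform a n
  drop-last = begin
    ∑[ i ≤ suc n ] h (toℕ i)
      ≡⟨ sum-init-last {suc n} (h ∘ toℕ) ⟩
    ∑[ i ≤ n ] h (toℕ (inject₁ i)) + h (toℕ (fromℕ (suc n)))
      ≡⟨ cong₂ _+_ (sum-cong-≗ {suc n} (cong h ∘ toℕ-inject₁)) h-last ⟩
    binomialTransform a n + 0ℚ
      ≡⟨ ℚ.+-identityʳ _ ⟩
    binomialTransform a n ∎

binomialTransform-cong : ∀ {a a′} → (∀ i → a i ≡ a′ i) →
  ∀ n → binomialTransform a n ≡ binomialTransform a′ n
binomialTransform-cong a≗a′ n =
  sum-cong-≗ {suc n} λ i → cong (fromℤ (+ (n C toℕ i)) *_) (a≗a′ (toℕ i))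

binomialTransform-linear : ∀ p q a a′ n →
  binomialTransform (λ i → p * a i + q * a′ i) n
    ≡ p * binomialTransform a n + q * binomialTransform a′ n
binomialTransform-linear p q a a′ n = begin
  binomialTransform (λ i → p * a i + q * a′ i) n
    ≡⟨ sum-cong-≗ {suc n} (λ i →
         solve 5 (λ c p q x y → c :* (p :* x :+ q :* y) := p :* (c :* x) :+ q :* (c :* y)) refl
           (fromℤ (+ (n C toℕ i))) p q (a (toℕ i)) (a′ (toℕ i))) ⟩
  ∑[ i ≤ n ] (p * t a i + q * t a′ i)
    ≡⟨ ∑-distrib-+ {suc n} (λ i → p * t a i) (λ i → q * t a′ i) ⟩
  ∑[ i ≤ n ] (p * t a i) + ∑[ i ≤ n ] (q * t a′ i)
    ≡⟨ cong₂ _+_ (*-distribˡ-sum {suc n} p (t a)) (*-distribˡ-sum {suc n} q (t a′)) ⟨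
  p * binomialTransform a n + q * binomialTransform a′ n ∎
  where
  open +-*-Solver
  t : (ℕ → ℚ) → Fin (suc n) → ℚ
  t s i = fromℤ (+ (n C toℕ i)) * s (toℕ i)

-- Since T acts as 1 + S, the characteristic roots move up by 1: substituting t - 1 for t in t² = p
-- t + q gives t² = (2 + p) t - (1 + p - q). Concretely, all three terms are combinations of `x` and
-- `y`, once `rec` removes the double shift.
binomialTransform-recurrence : ∀ p q a →
  (∀ n → a (2 ℕ.+ n) ≡ p * a (1 ℕ.+ n) + q * a n) → ∀ n →
  binomialTransform a (2 ℕ.+ n)
    ≡ (fromℤ (+ 2) + p) * binomialTransform a (1 ℕ.+ n)
      - (1ℚ + p - q) * binomialTransform a n
binomialTransform-recurrence p q a rec n = begin
  T a (2 ℕ.+ n)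
    ≡⟨ binomialTransform-suc a (1 ℕ.+ n) ⟩
  T a (1 ℕ.+ n) + T (a ∘ suc) (1 ℕ.+ n)
    ≡⟨ cong₂ _+_ (binomialTransform-suc a n) shifted ⟩
  (x + y) + (y + (p * y + q * x))
    ≡⟨ solve 4 (λ p q x y → (x :+ y) :+ (y :+ (p :* y :+ q :* x))
                   := (con (fromℤ (+ 2)) :+ p) :* (x :+ y) :- (con 1ℚ :+ p :- q) :* x)
         refl p q x y ⟩
  (fromℤ (+ 2) + p) * (x + y) - (1ℚ + p - q) * x
    ≡⟨ cong (λ z → (fromℤ (+ 2) + p) * z - (1ℚ + p - q) * x) (binomialTransform-suc a n) ⟨
  (fromℤ (+ 2) + p) * T a (1 ℕ.+ n) - (1ℚ + p - q) * x ∎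
  where
  open +-*-Solver
  T = binomialTransform
  x = T a n
  y = T (a ∘ suc) n

  shifted : T (a ∘ suc) (1 ℕ.+ n) ≡ y + (p * y + q * x)
  shifted = begin
    T (a ∘ suc) (1 ℕ.+ n)
      ≡⟨ binomialTransform-suc (a ∘ suc) n ⟩
    y + T (a ∘ suc ∘ suc) n
      ≡⟨ cong (_+_ y) (binomialTransform-cong rec n) ⟩
    y + T (λ i → p * a (suc i) + q * a i) n
      ≡⟨ cong (_+_ y) (binomialTransform-linear p q (a ∘ suc) a n) ⟩
    y + (p * y + q * x) ∎

-- The constant 2 solves the common recurrence, as 3 · 2 - 2 · 2 = 2, and the initial values also
-- differ by 2.
mersenneLucas≡2+mersenne : ∀ n → mersenneLucas n ≡ + 2 ℤ.+ mersenne n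
mersenneLucas≡2+mersenne 0             = refl
mersenneLucas≡2+mersenne 1             = refl
mersenneLucas≡2+mersenne (suc (suc n)) = trans
  (cong₂ (λ x y → + 3 ℤ.* x ℤ.- + 2 ℤ.* y)
         (mersenneLucas≡2+mersenne (suc n)) (mersenneLucas≡2+mersenne n))
  (identity (mersenne (suc n)) (mersenne n))
  where
  identity : ∀ x y → + 3 ℤ.* (+ 2 ℤ.+ x) ℤ.- + 2 ℤ.* (+ 2 ℤ.+ y)
                   ≡ + 2 ℤ.+ (+ 3 ℤ.* x ℤ.- + 2 ℤ.* y)
  identity = solve-∀

-- With 1 + M_m = 2^m this is 2^(m+n) - 1 = 2^m (2^n - 1) + (2^m - 1).
mersenne-+ : ∀ m n → mersenne (m ℕ.+ n) ≡ (1ℤ ℤ.+ mersenne m) ℤ.* mersenne n ℤ.+ mersenne m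
mersenne-+ m n = begin
  mersenne (m ℕ.+ n)
    ≡⟨ mersenne-closed (m ℕ.+ n) ⟩
  + (2 ℕ.^ (m ℕ.+ n)) ℤ.- 1ℤ
    ≡⟨ cong (λ x → + x ℤ.- 1ℤ) (ℕ.^-distribˡ-+-* 2 m n) ⟩
  + (2 ℕ.^ m ℕ.* 2 ℕ.^ n) ℤ.- 1ℤ
    ≡⟨ cong (ℤ._- 1ℤ) (ℤ.pos-* (2 ℕ.^ m) (2 ℕ.^ n)) ⟩
  + (2 ℕ.^ m) ℤ.* + (2 ℕ.^ n) ℤ.- 1ℤ
    ≡⟨ identity (+ (2 ℕ.^ m)) (+ (2 ℕ.^ n)) ⟩
  (1ℤ ℤ.+ (+ (2 ℕ.^ m) ℤ.- 1ℤ)) ℤ.* (+ (2 ℕ.^ n) ℤ.- 1ℤ) ℤ.+ (+ (2 ℕ.^ m) ℤ.- 1ℤ)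
    ≡⟨ cong₂ (λ x y → (1ℤ ℤ.+ x) ℤ.* y ℤ.+ x) (mersenne-closed m) (mersenne-closed n) ⟨
  (1ℤ ℤ.+ mersenne m) ℤ.* mersenne n ℤ.+ mersenne m ∎
  where
  identity : ∀ x y → x ℤ.* y ℤ.- + 1 ≡ (+ 1 ℤ.+ (x ℤ.- + 1)) ℤ.* (y ℤ.- + 1) ℤ.+ (x ℤ.- + 1)
  identity = solve-∀

-- M_(kn) = (2^k)^n - 1 has characteristic roots 2^k and 1, with sum m_k and product m_k - 1.
mersenne-*-recurrence : ∀ k n →
  mersenne (k ℕ.* (2 ℕ.+ n))
    ≡ mersenneLucas k ℤ.* mersenne (k ℕ.* (1 ℕ.+ n))
      ℤ.+ (1ℤ ℤ.- mersenneLucas k) ℤ.* mersenne (k ℕ.* n)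
mersenne-*-recurrence k n = begin
  mersenne (k ℕ.* (2 ℕ.+ n))
    ≡⟨ step (1 ℕ.+ n) ⟩
  (1ℤ ℤ.+ x) ℤ.* mersenne (k ℕ.* (1 ℕ.+ n)) ℤ.+ x
    ≡⟨ cong (λ z → (1ℤ ℤ.+ x) ℤ.* z ℤ.+ x) (step n) ⟩
  (1ℤ ℤ.+ x) ℤ.* ((1ℤ ℤ.+ x) ℤ.* y ℤ.+ x) ℤ.+ x
    ≡⟨ identity x y ⟩
  (+ 2 ℤ.+ x) ℤ.* ((1ℤ ℤ.+ x) ℤ.* y ℤ.+ x) ℤ.+ (1ℤ ℤ.- (+ 2 ℤ.+ x)) ℤ.* y
    ≡⟨ cong₂ (λ m z → m ℤ.* z ℤ.+ (1ℤ ℤ.- m) ℤ.* y) (mersenneLucas≡2+mersenne k) (step n) ⟨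
  mersenneLucas k ℤ.* mersenne (k ℕ.* (1 ℕ.+ n)) ℤ.+ (1ℤ ℤ.- mersenneLucas k) ℤ.* y ∎
  where
  x = mersenne k
  y = mersenne (k ℕ.* n)

  -- A first-order affine recurrence; used at `n` and `1 + n`, it reduces the claim to an identity
  -- in `x` and `y`.
  step : ∀ j → mersenne (k ℕ.* (1 ℕ.+ j)) ≡ (1ℤ ℤ.+ x) ℤ.* mersenne (k ℕ.* j) ℤ.+ x
  step j = trans (cong mersenne (ℕ.*-suc k j)) (mersenne-+ k (k ℕ.* j))

  identity : ∀ x y → (+ 1 ℤ.+ x) ℤ.* ((+ 1 ℤ.+ x) ℤ.* y ℤ.+ x) ℤ.+ x
    ≡ (+ 2 ℤ.+ x) ℤ.* ((+ 1 ℤ.+ x) ℤ.* y ℤ.+ x) ℤ.+ (+ 1 ℤ.- (+ 2 ℤ.+ x)) ℤ.* y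
  identity = solve-∀

module _ (k : ℕ) .{{_ : ℕ.NonZero k}} where

  private
    instance _ = mersenne-nonZero k
    m = fromℤ (mersenneLucas k)

  higherMersenne-recurrence : ∀ n →
    higherMersenne k (2 ℕ.+ n)
      ≡ m * higherMersenne k (1 ℕ.+ n) + (1ℚ - m) * higherMersenne k n
  higherMersenne-recurrence n = begin
    fromℤ (mersenne (k ℕ.* (2 ℕ.+ n))) * r
      ≡⟨ cong (λ z → fromℤ z * r) (mersenne-*-recurrence k n) ⟩
    fromℤ (mersenneLucas k ℤ.* x ℤ.+ (1ℤ ℤ.- mersenneLucas k) ℤ.* y) * r
      ≡⟨ cong (_* r) (fromℤ-homo-+ (mersenneLucas k ℤ.* x) _) ⟩
    (fromℤ (mersenneLucas k ℤ.* x) + fromℤ ((1ℤ ℤ.- mersenneLucas k) ℤ.* y)) * r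
      ≡⟨ cong₂ (λ u v → (u + v) * r)
           (fromℤ-homo-* (mersenneLucas k) x)
           (trans (fromℤ-homo-* (1ℤ ℤ.- mersenneLucas k) y)
                  (cong (_* fromℤ y) (fromℤ-homo-- 1ℤ (mersenneLucas k)))) ⟩
    (m * fromℤ x + (1ℚ - m) * fromℤ y) * r
      -- Division by the fixed `mersenne k` is a common factor `r`, so the relation between
      -- numerators passes to the quotients.
      ≡⟨ solve 5 (λ m l x y r → (m :* x :+ l :* y) :* r := m :* (x :* r) :+ l :* (y :* r))
           refl m (1ℚ - m) (fromℤ x) (fromℤ y) r ⟩
    m * (fromℤ x * r) + (1ℚ - m) * (fromℤ y * r) ∎
    where
    open +-*-Solver
    x = mersenne (k ℕ.* (1 ℕ.+ n))
    y = mersenne (k ℕ.* n)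
    r = 1/ fromℤ (mersenne k)

  higherMersenne-0 : higherMersenne k 0 ≡ 0ℚ
  higherMersenne-0 = trans
    (cong (λ j → fromℤ (mersenne j) * 1/ fromℤ (mersenne k)) (ℕ.*-zeroʳ k))
    (ℚ.*-zeroˡ (1/ fromℤ (mersenne k)))

  higherMersenne-1 : higherMersenne k 1 ≡ 1ℚ
  higherMersenne-1 = trans
    (cong (λ j → fromℤ (mersenne j) * 1/ fromℤ (mersenne k)) (ℕ.*-identityʳ k))
    (ℚ.*-inverseʳ (fromℤ (mersenne k)))

  b-recurrence : ∀ n →
    b k (2 ℕ.+ n) ≡ (fromℤ (+ 2) + m) * b k (1 ℕ.+ n) - fromℤ (+ 2) * m * b k n
  b-recurrence n = trans
    (binomialTransform-recurrence m (1ℚ - m) (higherMersenne k) higherMersenne-recurrence n)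
    (cong (λ c → (fromℤ (+ 2) + m) * b k (1 ℕ.+ n) - c * b k n)
      (solve 1 (λ m → con 1ℚ :+ m :- (con 1ℚ :- m) := con (fromℤ (+ 2)) :* m) refl m))
    where open +-*-Solver

theorem2p22 : (k : ℕ) → .{{_ : ℕ.NonZero k}} →
    (∀ n → 1 ≤ n →
    b k (n ℕ.+ 1) ≡ (fromℤ (+ 2) + fromℤ (mersenneLucas k)) * b k n
    - fromℤ (+ 2) * fromℤ (mersenneLucas k) * b k (n ∸ 1))
    × b k 0 ≡ 0ℚ
    × b k 1 ≡ 1ℚ
theorem2p22 k =
    -- Matching on `1 ≤ n` lets `n ∸ 1` compute; `suc n + 1` must be commuted to reach the form
    -- `2 + n`.
    (λ { (suc n) (s≤s _) → trans (cong (b k) (ℕ.+-comm (suc n) 1)) (b-recurrence k n) })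
  -- At 0 and 1 all binomial coefficients are 1; once the values 0 and 1 are inserted, closed
  -- rational arithmetic finishes.
  , cong (λ x → fromℤ (+ 1) * x + 0ℚ) (higherMersenne-0 k)
  , cong₂ (λ x y → fromℤ (+ 1) * x + (fromℤ (+ 1) * y + 0ℚ))
      (higherMersenne-0 k) (higherMersenne-1 k)
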